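{- Let $X=\prod_{i=1}^n X_i$, where each $X_i$ is a finite interval of integers with $|X_i|\ge 2$, and let $F=(f_1,\dots,f_n):X\to X$. Let $I\subseteq\{1,\dots,n\}$ be such that, for every $(x,v)\in X'$, each positive circuit of the local interaction graph $\mathbf{G}_F(x,v)$ has at least one vertex in $I$. Then the number of fixed points of $F$ is less than or equal to $\prod_{i\in I}|X_i|$.
   Context: $X'$ is the set of pairs $(x,v)$ with $x\in X$, $v\in\{ -1,1\}^n$ and $x+v\in X$. Let $e_j$ be the $j$-th standard unit vector. For $(x,v)\in X'$ and $i,j\in\{1,\dots,n\}$ set $f_{ij}(x,v)=\big(f_i(x+v_je_j)-f_i(x)\big)/v_j$. An interaction graph is a directed graph on vertex set $\{1,\dots,n\}$ whose edges are triples $(j,s,i)$ with $s\in\{ -1,1\}$ (edge from $j$ to $i$ with sign $s$); there may be both a positive and a negative edge from $j$ to $i$, and loops are allowed. The local interaction graph $\mathbf{G}_F(x,v)$ contains the edge $(j,1,i)$ iff $f_{ij}(x,v)>0$ and the edge $(j,-1,i)$ iff $f_{ij}(x,v)<0$. A positive circuit is a non-empty sequence of edges $(j_1,s_1,i_1),\dots,(j_r,s_r,i_r)$ with $i_k=j_{k+1}$ for $1\le k<r$, $i_r=j_1$, the vertices $j_1,\dots,j_r$ pairwise distinct, and $\prod_k s_k=1$; its vertices are $j_1,\dots,j_r$. -}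

module Defs where

open import Data.Nat as ℕ using (ℕ; zero; suc)
open import Data.Integer as ℤ using (ℤ; 0ℤ; 1ℤ; -1ℤ; ∣_∣)
open import Data.Fin using (Fin)
import Data.Fin as Fin
open import Data.Fin.Subset using (Subset; _∈_)
open import Data.Vec using (Vec; []; _∷_; lookup; zipWith; _[_]≔_)
open import Data.Bool using (true; false)
open import Data.Sign as Sign using (Sign)
open import Data.List using (List; []; _∷_; map; foldr; length)
open import Data.List.Relation.Unary.All using (All)
open import Data.List.Relation.Unary.Any using (Any)
open import Data.List.Relation.Unary.Unique.Propositional using (Unique)
open import Data.Product using (_×_; _,_; proj₁; proj₂)
open import Relation.Binary.PropositionalEquality using (_≡_)

-- A point of ℤⁿ
Point : ℕ → Set
Point n = Vec ℤ n

-- The box X = ∏ [a_i , b_i]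
InBox : ∀ {n} → Vec ℤ n → Vec ℤ n → Point n → Set
InBox {n} a b x = (i : Fin n) → (lookup a i ℤ.≤ lookup x i) × (lookup x i ℤ.≤ lookup b i)

-- |X_i| = b_i - a_i + 1
size : ∀ {n} → Vec ℤ n → Vec ℤ n → Fin n → ℕ
size a b i = suc ∣ lookup b i ℤ.- lookup a i ∣

-- a sign as the integer ±1
toℤ : Sign → ℤ
toℤ Sign.+ = 1ℤ
toℤ Sign.- = -1ℤ

-- x + v for v ∈ {-1,1}ⁿ
_⊕_ : ∀ {n} → Point n → Vec Sign n → Point n
x ⊕ v = zipWith (λ a s → a ℤ.+ toℤ s) x v

-- x + v_j e_j
step : ∀ {n} → Point n → Vec Sign n → Fin n → Point n
step x v j = x [ j ]≔ (lookup x j ℤ.+ toℤ (lookup v j))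

-- f_{ij}(x,v) = (f_i(x + v_j e_j) - f_i(x)) / v_j ; dividing by v_j ∈ {±1}
-- is the same as multiplying by v_j.
fij : ∀ {n} → (Point n → Point n) → Point n → Vec Sign n → Fin n → Fin n → ℤ
fij F x v i j = toℤ (lookup v j) ℤ.* (lookup (F (step x v j)) i ℤ.- lookup (F x) i)

-- Edges (j , s , i): edge from j to i with sign s
Edge : ℕ → Set
Edge n = Fin n × Sign × Fin n

-- membership of an edge in the local interaction graph G_F(x,v)
InLocalGraph : ∀ {n} → (Point n → Point n) → Point n → Vec Sign n → Edge n → Set
InLocalGraph F x v (j , Sign.+ , i) = 0ℤ ℤ.< fij F x v i j
InLocalGraph F x v (j , Sign.- , i) = fij F x v i j ℤ.< 0ℤ

-- A circuit is described by its list [(j₁,s₁),…,(j_r,s_r)]; its edges are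
-- (j_k, s_k, j_{k+1}) for k < r and (j_r, s_r, j₁).
private
  go : ∀ {n} → Fin n → List (Fin n × Sign) → List (Edge n)
  go first [] = []
  go first ((j , s) ∷ []) = (j , s , first) ∷ []
  go first ((j , s) ∷ (j' , s') ∷ rest) = (j , s , j') ∷ go first ((j' , s') ∷ rest)

edgesOf : ∀ {n} → List (Fin n × Sign) → List (Edge n)
edgesOf [] = []
edgesOf ((j , s) ∷ rest) = go j ((j , s) ∷ rest)

NonEmpty : ∀ {A : Set} → List A → Set
NonEmpty [] = Data.Empty.⊥ where import Data.Empty
NonEmpty (_ ∷ _) = Data.Unit.⊤ where import Data.Unit

-- positive circuit in G_F(x,v): non-empty, pairwise distinct vertices,
-- all edges in the graph, product of signs equal to +
PositiveCircuit : ∀ {n} → (Point n → Point n) → Point n → Vec Sign n →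
                  List (Fin n × Sign) → Set
PositiveCircuit F x v cs =
  NonEmpty cs
  × Unique (map proj₁ cs)
  × All (InLocalGraph F x v) (edgesOf cs)
  × foldr Sign._*_ Sign.+ (map proj₂ cs) ≡ Sign.+

-- ∏_{i ∈ I} f i
∏∈ : ∀ {n} → Subset n → (Fin n → ℕ) → ℕ
∏∈ {zero} [] f = 1
∏∈ {suc n} (true ∷ p) f = f Fin.zero ℕ.* ∏∈ p (λ i → f (Fin.suc i))
∏∈ {suc n} (false ∷ p) f = ∏∈ p (λ i → f (Fin.suc i))

module Submission where

-- Proof strategy.  Fixed points in X are determined by their I-coordinates,
-- which range over a set of size ∏_{i ∈ I} |X_i|; the bound then follows by
-- pigeonhole.  The content is: two fixed points p, y agreeing on I are equal.
-- Call q "good" if every coordinate of q lies between p's and y's, and F does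
-- not push any coordinate where q differs from p back towards p; y is good.
-- From a good q ≠ p we step one coordinate towards p, staying good.  If that
-- is impossible, take v ∈ {-1,1}ⁿ pointing towards p on the displaced
-- coordinates: each displaced k then has an edge k → i of G_F(q, v), of sign
-- σ k · σ i (σ = direction from p to y), to a displaced i.  A cycle of such
-- edges is a positive circuit whose vertices are displaced, hence avoid I.
--
-- Order of the file: counting (pigeonhole, encoding of I-coordinates), integer
-- orders oriented by a sign, cycles in finite graphs and balanced cycles as
-- positive circuits, the descent (module Coincidence), and the theorem.

open import Defs
open import Data.Nat as ℕ using (ℕ; zero; suc; _≤_)
import Data.Nat.Properties as ℕP
open import Data.Nat.DivMod using (_mod_; m<n⇒m%n≡m)
open import Data.Integer as ℤ using (ℤ; _<_; +_; ∣_∣; 0ℤ; 1ℤ; -1ℤ)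
import Data.Integer.Properties as ℤP
open import Data.Fin as Fin using (Fin; toℕ)
import Data.Fin.Properties as FinP
open import Data.Fin.Subset using (Subset; _∈_)
open import Data.Vec using (Vec; []; _∷_; lookup; tabulate; _[_]≔_; here; there)
import Data.Vec.Properties as VecP
import Data.List.Properties as ListP
open import Data.Bool using (true; false)
open import Data.Sign as Sign using (Sign; opposite)
import Data.Sign.Properties as SignP
open import Data.List as List using (List; []; _∷_; length; map; foldr; drop)
open import Data.List.Relation.Unary.All as All using (All; []; _∷_)
import Data.List.Relation.Unary.All.Properties as AllP
open import Data.List.Relation.Unary.Any as Any using (Any)
import Data.List.Relation.Unary.Any.Properties as AnyP
open import Data.List.Relation.Unary.AllPairs using (AllPairs; []; _∷_)
open import Data.List.Relation.Unary.Unique.Propositional using (Unique)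
open import Data.List.Membership.Propositional using () renaming (_∈_ to _∈ₗ_; _∉_ to _∉ₗ_)
open import Data.List.Membership.Propositional.Properties using (∈-lookup)
import Data.List.Membership.DecPropositional as DecMembership
open import Data.Product using (Σ; _×_; _,_; proj₁; proj₂)
open import Data.Sum using (_⊎_; inj₁; inj₂)
open import Data.Unit using (tt)
open import Data.Empty using (⊥; ⊥-elim)
open import Function using (_∘_; id)
open import Relation.Binary.PropositionalEquality
open import Relation.Nullary using (¬_; Dec; yes; no)
open import Relation.Nullary.Decidable using (_×-dec_; _⊎-dec_; ¬?; decidable-stable)

-- Entries of a list satisfying `AllPairs R` are R-related whenever the
-- first index precedes the second.
allPairs-lookup : ∀ {A : Set} {R : A → A → Set} {xs : List A} → AllPairs R xs →
                  ∀ {i j : Fin (length xs)} → i Fin.< j →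
                  R (List.lookup xs i) (List.lookup xs j)
allPairs-lookup (Rx ∷ _)   {Fin.zero}  {Fin.suc j} _         = All.lookup Rx (∈-lookup j)
allPairs-lookup (_  ∷ Rxs) {Fin.suc i} {Fin.suc j} (ℕ.s≤s i<j) = allPairs-lookup Rxs i<j

-- Pigeonhole for lists: a duplicate-free list of elements of Fin m has
-- at most m entries.
unique-length-≤ : ∀ {m} (xs : List (Fin m)) → Unique xs → length xs ≤ m
unique-length-≤ {m} xs xs! with length xs ℕP.≤? m
... | yes fits = fits
... | no  overflows
  with i , j , i<j , same ← FinP.pigeonhole (ℕP.≰⇒> overflows) (List.lookup xs)
  = ⊥-elim (allPairs-lookup xs! i<j same)

-- A map that is injective on the entries of a list (those satisfying P)
-- preserves duplicate-freeness of that list.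
unique-map-on : ∀ {A B : Set} {P : A → Set} (f : A → B) →
                (∀ {x z} → P x → P z → f x ≡ f z → x ≡ z) →
                ∀ {xs} → All P xs → Unique xs → Unique (List.map f xs)
unique-map-on f inj []         []           = []
unique-map-on f inj (px ∷ pxs) (x∉xs ∷ xs!) =
  AllP.map⁺ (All.zipWith (λ (pz , x≢z) → x≢z ∘ inj px pz) (pxs , x∉xs))
  ∷ unique-map-on f inj pxs xs!

-- For i ≤ j the natural number ∣ j - i ∣ is the distance j - i itself.
gap : ∀ {i j} → i ℤ.≤ j → + ∣ j ℤ.- i ∣ ≡ j ℤ.- i
gap {i} {j} i≤j = trans (cong +_ (ℤP.∣i-j∣≡∣j-i∣ j i)) (ℤP.∣-∣-≤ i≤j)

-- Subtracting a fixed integer is injective.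
-‿cancelʳ : ∀ i j k → i ℤ.- k ≡ j ℤ.- k → i ≡ j
-‿cancelʳ i j k eq = ℤP.i-j≡0⇒i≡j i j (begin
  i ℤ.- j                   ≡⟨ sym (ℤP.+-minus-telescope i k j) ⟩
  (i ℤ.- k) ℤ.+ (k ℤ.- j)   ≡⟨ cong (ℤ._+ (k ℤ.- j)) eq ⟩
  (j ℤ.- k) ℤ.+ (k ℤ.- j)   ≡⟨ ℤP.+-minus-telescope j k j ⟩
  j ℤ.- j                   ≡⟨ ℤP.i≡j⇒i-j≡0 {j} refl ⟩
  0ℤ                        ∎)
  where open ≡-Reasoning

-- The position c - a of a point c of the interval [a , b], as an element of
-- Fin |[a , b]|; outside the interval the value is irrelevant.
position : (a b c : ℤ) → Fin (suc ∣ b ℤ.- a ∣)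
position a b c = ∣ c ℤ.- a ∣ mod suc ∣ b ℤ.- a ∣

-- Within the interval the encoding is exact: position c = c - a.
toℕ-position : ∀ {a b c} → a ℤ.≤ c → c ℤ.≤ b → toℕ (position a b c) ≡ ∣ c ℤ.- a ∣
toℕ-position {a} {b} {c} a≤c c≤b =
  trans (FinP.toℕ-fromℕ< _) (m<n⇒m%n≡m (ℕ.s≤s (ℤP.drop‿+≤+ c-a≤b-a)))
  where
  c-a≤b-a : + ∣ c ℤ.- a ∣ ℤ.≤ + ∣ b ℤ.- a ∣
  c-a≤b-a = subst₂ ℤ._≤_ (sym (gap a≤c)) (sym (gap (ℤP.≤-trans a≤c c≤b)))
                   (ℤP.+-monoˡ-≤ (ℤ.- a) c≤b)

-- Points of [a , b] are determined by their position.
position-injective : ∀ {a b c c'} → a ℤ.≤ c → c ℤ.≤ b → a ℤ.≤ c' → c' ℤ.≤ b →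
                     position a b c ≡ position a b c' → c ≡ c'
position-injective {a} {b} {c} {c'} a≤c c≤b a≤c' c'≤b same =
  -‿cancelʳ c c' a (begin
    c ℤ.- a                      ≡⟨ sym (gap a≤c) ⟩
    + ∣ c ℤ.- a ∣                ≡⟨ cong +_ (sym (toℕ-position a≤c c≤b)) ⟩
    + toℕ (position a b c)       ≡⟨ cong (+_ ∘ toℕ) same ⟩
    + toℕ (position a b c')      ≡⟨ cong +_ (toℕ-position a≤c' c'≤b) ⟩
    + ∣ c' ℤ.- a ∣               ≡⟨ gap a≤c' ⟩
    c' ℤ.- a                     ∎)
  where open ≡-Reasoning

-- The I-coordinates of a point, packed into a single element of
-- Fin (∏_{i ∈ I} |X_i|) (mixed-radix encoding).
encode : ∀ {n} (a b : Vec ℤ n) (I : Subset n) → Point n → Fin (∏∈ I (size a b))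
encode []         []         []          []       = Fin.zero
encode (a₀ ∷ a) (b₀ ∷ b) (true  ∷ I) (x₀ ∷ x) = Fin.combine (position a₀ b₀ x₀) (encode a b I x)
encode (a₀ ∷ a) (b₀ ∷ b) (false ∷ I) (x₀ ∷ x) = encode a b I x

-- Two points of the box with the same code agree on every coordinate in I.
encode-injective-on : ∀ {n} (a b : Vec ℤ n) (I : Subset n) {x z : Point n} →
                      InBox a b x → InBox a b z → encode a b I x ≡ encode a b I z →
                      ∀ i → i ∈ I → lookup x i ≡ lookup z i
encode-injective-on (a₀ ∷ a) (b₀ ∷ b) (true ∷ I) {x₀ ∷ x} {z₀ ∷ z} x∈ z∈ same Fin.zero here =
  position-injective (proj₁ (x∈ Fin.zero)) (proj₂ (x∈ Fin.zero)) (proj₁ (z∈ Fin.zero)) (proj₂ (z∈ Fin.zero))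
    (FinP.combine-injectiveˡ (position a₀ b₀ x₀) (encode a b I x) (position a₀ b₀ z₀) (encode a b I z) same)
encode-injective-on (a₀ ∷ a) (b₀ ∷ b) (true ∷ I) {x₀ ∷ x} {z₀ ∷ z} x∈ z∈ same (Fin.suc i) (there i∈I) =
  encode-injective-on a b I (x∈ ∘ Fin.suc) (z∈ ∘ Fin.suc)
    (FinP.combine-injectiveʳ (position a₀ b₀ x₀) (encode a b I x) (position a₀ b₀ z₀) (encode a b I z) same) i i∈I
encode-injective-on (a₀ ∷ a) (b₀ ∷ b) (false ∷ I) {_ ∷ x} {_ ∷ z} x∈ z∈ same (Fin.suc i) (there i∈I) =
  encode-injective-on a b I (x∈ ∘ Fin.suc) (z∈ ∘ Fin.suc) same i i∈I

-- `u ≤[ s ] w`: u comes weakly before w when walking in direction s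
-- (the usual order for s = +, the reversed one for s = −).
_≤[_]_ : ℤ → Sign → ℤ → Set
u ≤[ Sign.+ ] w = u ℤ.≤ w
u ≤[ Sign.- ] w = w ℤ.≤ u

_<[_]_ : ℤ → Sign → ℤ → Set
u <[ Sign.+ ] w = u ℤ.< w
u <[ Sign.- ] w = w ℤ.< u

-- The oriented orders inherit the order laws of ℤ (case by case on the sign).
≤σ-reflexive : ∀ s {u w} → u ≡ w → u ≤[ s ] w
≤σ-reflexive Sign.+ refl = ℤP.≤-refl
≤σ-reflexive Sign.- refl = ℤP.≤-refl

≤σ-trans : ∀ s {u v w} → u ≤[ s ] v → v ≤[ s ] w → u ≤[ s ] w
≤σ-trans Sign.+ u≤v v≤w = ℤP.≤-trans u≤v v≤w
≤σ-trans Sign.- u≤v v≤w = ℤP.≤-trans v≤w u≤v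

≤σ-antisym : ∀ s {u w} → u ≤[ s ] w → w ≤[ s ] u → u ≡ w
≤σ-antisym Sign.+ u≤w w≤u = ℤP.≤-antisym u≤w w≤u
≤σ-antisym Sign.- u≤w w≤u = ℤP.≤-antisym w≤u u≤w

<σ-≤σ-trans : ∀ s {u v w} → u <[ s ] v → v ≤[ s ] w → u <[ s ] w
<σ-≤σ-trans Sign.+ u<v v≤w = ℤP.<-≤-trans u<v v≤w
<σ-≤σ-trans Sign.- u<v v≤w = ℤP.≤-<-trans v≤w u<v

≤σ-<σ-trans : ∀ s {u v w} → u ≤[ s ] v → v <[ s ] w → u <[ s ] w
≤σ-<σ-trans Sign.+ u≤v v<w = ℤP.≤-<-trans u≤v v<w
≤σ-<σ-trans Sign.- u≤v v<w = ℤP.<-≤-trans v<w u≤v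

<σ⇒≤σ : ∀ s {u w} → u <[ s ] w → u ≤[ s ] w
<σ⇒≤σ Sign.+ = ℤP.<⇒≤
<σ⇒≤σ Sign.- = ℤP.<⇒≤

≰σ⇒>σ : ∀ s {u w} → ¬ (u ≤[ s ] w) → w <[ s ] u
≰σ⇒>σ Sign.+ = ℤP.≰⇒>
≰σ⇒>σ Sign.- = ℤP.≰⇒>

_≤σ?_ : ∀ {s} u w → Dec (u ≤[ s ] w)
_≤σ?_ {Sign.+} u w = u ℤ.≤? w
_≤σ?_ {Sign.-} u w = w ℤ.≤? u

-- A point between p and y (in direction s) lies in every interval
-- [a , b] containing p and y.
between-in-interval : ∀ s {a b p q y} → a ℤ.≤ p → p ℤ.≤ b → a ℤ.≤ y → y ℤ.≤ b →
                      p ≤[ s ] q → q ≤[ s ] y → (a ℤ.≤ q) × (q ℤ.≤ b)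
between-in-interval Sign.+ a≤p p≤b a≤y y≤b p≤q q≤y = ℤP.≤-trans a≤p p≤q , ℤP.≤-trans q≤y y≤b
between-in-interval Sign.- a≤p p≤b a≤y y≤b q≤p y≤q = ℤP.≤-trans a≤y y≤q , ℤP.≤-trans q≤p p≤b

-- One unit step backwards, i.e. against the direction s.
retreat : Sign → ℤ → ℤ
retreat s u = u ℤ.+ toℤ (opposite s)

retreat-< : ∀ s u → retreat s u <[ s ] u
retreat-< Sign.+ u = subst (ℤ._< u) (ℤP.+-comm -1ℤ u) (ℤP.i≤pred[j]⇒i<j ℤP.≤-refl)
retreat-< Sign.- u = subst (u ℤ.<_) (ℤP.+-comm 1ℤ u) (ℤP.suc[i]≤j⇒i<j ℤP.≤-refl)

-- Retreating from u ≠ p towards p does not overshoot p.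
retreat-not-past : ∀ s {p u} → p ≤[ s ] u → u ≢ p → p ≤[ s ] retreat s u
retreat-not-past Sign.+ {p} {u} p≤u u≢p =
  subst (p ℤ.≤_) (ℤP.+-comm -1ℤ u) (ℤP.i<j⇒i≤pred[j] (ℤP.≤∧≢⇒< p≤u (u≢p ∘ sym)))
retreat-not-past Sign.- {p} {u} u≤p u≢p =
  subst (ℤ._≤ p) (ℤP.+-comm 1ℤ u) (ℤP.i<j⇒suc[i]≤j (ℤP.≤∧≢⇒< u≤p u≢p))

-- ... and strictly decreases the distance to p.
retreat-closer : ∀ s {p u} → p ≤[ s ] u → u ≢ p → ∣ retreat s u ℤ.- p ∣ ℕ.< ∣ u ℤ.- p ∣
retreat-closer Sign.+ {p} {u} p≤u u≢p = ℤP.drop‿+<+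
  (subst₂ ℤ._<_ (sym (gap (retreat-not-past Sign.+ p≤u u≢p))) (sym (gap p≤u))
          (ℤP.+-monoˡ-< (ℤ.- p) (retreat-< Sign.+ u)))
retreat-closer Sign.- {p} {u} u≤p u≢p = subst₂ ℕ._<_
  (ℤP.∣i-j∣≡∣j-i∣ p (retreat Sign.- u)) (ℤP.∣i-j∣≡∣j-i∣ p u)
  (ℤP.drop‿+<+ (subst₂ ℤ._<_ (sym (gap (retreat-not-past Sign.- u≤p u≢p))) (sym (gap u≤p))
                       (ℤP.+-monoʳ-< p (ℤP.neg-mono-< (retreat-< Sign.- u)))))

-- `HasSign s z`: the integer z is strictly positive (s = +) or strictly
-- negative (s = −); membership of an edge with sign s in a local interaction
-- graph is exactly `HasSign s` of the corresponding f_ij.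
HasSign : Sign → ℤ → Set
HasSign Sign.+ z = 0ℤ ℤ.< z
HasSign Sign.- z = z ℤ.< 0ℤ

inLocalGraph : ∀ {n} (F : Point n → Point n) x v j i s →
               HasSign s (fij F x v i j) → InLocalGraph F x v (j , s , i)
inLocalGraph F x v j i Sign.+ pos = pos
inLocalGraph F x v j i Sign.- neg = neg

-- The sign of a difference of two distinct integers.
difference-negative : ∀ {f' f} → f' ℤ.< f → f' ℤ.- f ℤ.< 0ℤ
difference-negative {f'} {f} f'<f =
  subst (f' ℤ.- f ℤ.<_) (ℤP.+-inverseʳ f) (ℤP.+-monoˡ-< (ℤ.- f) f'<f)

difference-positive : ∀ {f' f} → f ℤ.< f' → 0ℤ ℤ.< f' ℤ.- f
difference-positive {f'} {f} f<f' =
  subst (ℤ._< f' ℤ.- f) (ℤP.+-inverseʳ f) (ℤP.+-monoˡ-< (ℤ.- f) f<f')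

-- If the value f moves to f' against direction sᵢ, then the difference
-- quotient along a step in direction opposite sₖ has sign sₖ·sᵢ.
quotient-sign : ∀ sₖ sᵢ {f' f} → f' <[ sᵢ ] f →
                HasSign (sₖ Sign.* sᵢ) (toℤ (opposite sₖ) ℤ.* (f' ℤ.- f))
quotient-sign Sign.+ Sign.+ {f'} {f} f'<f =
  subst (0ℤ ℤ.<_) (sym (ℤP.-1*i≡-i (f' ℤ.- f))) (ℤP.neg-mono-< (difference-negative f'<f))
quotient-sign Sign.+ Sign.- {f'} {f} f<f' =
  subst (ℤ._< 0ℤ) (sym (ℤP.-1*i≡-i (f' ℤ.- f))) (ℤP.neg-mono-< (difference-positive f<f'))
quotient-sign Sign.- Sign.+ {f'} {f} f'<f =
  subst (ℤ._< 0ℤ) (sym (ℤP.*-identityˡ (f' ℤ.- f))) (difference-negative f'<f)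
quotient-sign Sign.- Sign.- {f'} {f} f<f' =
  subst (0ℤ ℤ.<_) (sym (ℤP.*-identityˡ (f' ℤ.- f))) (difference-positive f<f')

-- `Chain R (j ∷ js) t`: consecutive entries of j ∷ js are R-related and the
-- last one is R-related to t.
Chain : ∀ {A : Set} → (A → A → Set) → List A → A → Set
Chain R []            t = ⊥
Chain R (j ∷ [])      t = R j t
Chain R (j ∷ j' ∷ js) t = R j j' × Chain R (j' ∷ js) t

-- A cycle of R with pairwise distinct vertices, all satisfying P.
record Cycle {n : ℕ} (P : Fin n → Set) (R : Fin n → Fin n → Set) : Set where
  constructor cycle
  field
    start    : Fin n
    rest     : List (Fin n)
    distinct : Unique (start ∷ rest)
    inside   : All P (start ∷ rest)
    closed   : Chain R (start ∷ rest) start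

-- In a finite digraph, if every vertex of P has an R-successor in P, then
-- any vertex of P leads to a cycle inside P: walk along successors until a
-- vertex repeats (which must happen within n steps).
module CycleSearch {n : ℕ} {P : Fin n → Set} {R : Fin n → Fin n → Set}
                   (successor : ∀ k → P k → Σ (Fin n) λ i → P i × R k i) where

  open DecMembership (FinP._≟_ {n}) using (_∈?_)

  -- The first half of `Unique (k ∷ xs)`, from k ∉ xs.
  ∉⇒All≢ : ∀ {k : Fin n} {xs} → k ∉ₗ xs → All (k ≢_) xs
  ∉⇒All≢ k∉ = All.tabulate λ { x∈ refl → k∉ x∈ }

  -- A path from k through vertices outside `visited` that re-enters `visited`.
  record Reentry (visited : List (Fin n)) (k : Fin n) : Set where
    constructor reentry
    field
      target   : Fin n
      target∈  : target ∈ₗ visited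
      path     : List (Fin n)
      distinct : Unique (k ∷ path)
      inside   : All P (k ∷ path)
      fresh    : All (_∉ₗ visited) (k ∷ path)
      chain    : Chain R (k ∷ path) target

  -- Walk from k, never revisiting `visited`; the fuel bound guarantees
  -- termination since `k ∷ visited` is duplicate-free, hence of length ≤ n.
  walk : (fuel : ℕ) (visited : List (Fin n)) (k : Fin n) → P k → k ∉ₗ visited →
         Unique visited → n ≤ length visited ℕ.+ fuel → Cycle P R ⊎ Reentry visited k
  walk zero visited k _ k∉ visited! n≤ = ⊥-elim (ℕP.<-irrefl refl (ℕP.≤-trans too-many no-fuel))
    where
    too-many : length (k ∷ visited) ≤ n
    too-many = unique-length-≤ (k ∷ visited) (∉⇒All≢ k∉ ∷ visited!)
    no-fuel : n ≤ length visited
    no-fuel = subst (n ≤_) (ℕP.+-identityʳ _) n≤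
  walk (suc fuel) visited k Pk k∉ visited! n≤ with successor k Pk
  ... | w , Pw , kRw with w FinP.≟ k
  ...   | yes refl = inj₁ (cycle k [] ([] ∷ []) (Pk ∷ []) kRw)
  ...   | no w≢k with w ∈? visited
  ...     | yes w∈ = inj₂ (reentry w w∈ [] ([] ∷ []) (Pk ∷ []) (k∉ ∷ []) kRw)
  ...     | no w∉ with walk fuel (k ∷ visited) w Pw (λ { (Any.here w≡k) → w≢k w≡k ; (Any.there w∈) → w∉ w∈ })
                          (∉⇒All≢ k∉ ∷ visited!)
                          (subst (n ≤_) (ℕP.+-suc (length visited) fuel) n≤)
  ...       | inj₁ found = inj₁ found
  ...       | inj₂ (reentry t (Any.here refl) path path! inP fresh chain) =
                inj₁ (cycle k (w ∷ path) (All.map (λ x∉ k≡x → x∉ (Any.here (sym k≡x))) fresh ∷ path!)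
                        (Pk ∷ inP) (kRw , chain))
  ...       | inj₂ (reentry t (Any.there t∈) path path! inP fresh chain) =
                inj₂ (reentry t t∈ (w ∷ path) (All.map (λ x∉ k≡x → x∉ (Any.here (sym k≡x))) fresh ∷ path!)
                        (Pk ∷ inP) (k∉ ∷ All.map (λ x∉ → x∉ ∘ Any.there) fresh) (kRw , chain))

  findCycle : ∀ k → P k → Cycle P R
  findCycle k Pk with walk n [] k Pk (λ ()) [] ℕP.≤-refl
  ... | inj₁ found = found
  ... | inj₂ (reentry _ () _ _ _ _ _)

-- (a·b)·(b·c) = a·c for signs: consecutive sign labels telescope.
sign-telescope : ∀ a b c → (a Sign.* b) Sign.* (b Sign.* c) ≡ a Sign.* c
sign-telescope a b c = begin
  (a Sign.* b) Sign.* (b Sign.* c)   ≡⟨ SignP.*-assoc a b (b Sign.* c) ⟩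
  a Sign.* (b Sign.* (b Sign.* c))   ≡⟨ cong (a Sign.*_) (sym (SignP.*-assoc b b c)) ⟩
  a Sign.* ((b Sign.* b) Sign.* c)   ≡⟨ cong (λ s → a Sign.* (s Sign.* c)) (SignP.s*s≡+ b) ⟩
  a Sign.* c                         ∎
  where open ≡-Reasoning

-- Given a sign σ for every vertex, an edge k → i is balanced when its sign
-- is σ k · σ i.  Every cycle of balanced edges is a positive circuit,
-- because the product of the signs telescopes to σ j · σ j = +.
module BalancedCycles {n : ℕ} (σ : Fin n → Sign) (E : Edge n → Set) where

  Balanced : Fin n → Fin n → Set
  Balanced k i = E (k , σ k Sign.* σ i , i)

  -- The circuit through the vertices of a path closed at `first`, each
  -- vertex labelled by the sign of its outgoing balanced edge.
  labelled : Fin n → List (Fin n) → List (Fin n × Sign)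
  labelled first []            = []
  labelled first (j ∷ [])      = (j , σ j Sign.* σ first) ∷ []
  labelled first (j ∷ j' ∷ js) = (j , σ j Sign.* σ j') ∷ labelled first (j' ∷ js)

  labelled-vertices : ∀ first js → map proj₁ (labelled first js) ≡ js
  labelled-vertices first []            = refl
  labelled-vertices first (j ∷ [])      = refl
  labelled-vertices first (j ∷ j' ∷ js) = cong (j ∷_) (labelled-vertices first (j' ∷ js))

  labelled-sign : ∀ first j js →
                  foldr Sign._*_ Sign.+ (map proj₂ (labelled first (j ∷ js))) ≡ σ j Sign.* σ first
  labelled-sign first j []        = SignP.*-identityʳ _
  labelled-sign first j (j' ∷ js) =
    trans (cong ((σ j Sign.* σ j') Sign.*_) (labelled-sign first j' js)) (sign-telescope (σ j) (σ j') (σ first))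

  -- `edgesOf ((first , s) ∷ cs)` is the edge first → (head of cs) followed
  -- by the edges of cs closed at `first`; dropping that first edge lets us
  -- reason by induction on cs.
  labelled-edges : ∀ first js → Chain Balanced js first →
                   All E (drop 1 (edgesOf ((first , Sign.+) ∷ labelled first js)))
  labelled-edges first (j ∷ [])           jRf         = jRf ∷ []
  labelled-edges first (j ∷ j' ∷ [])      (jRj' , c)  = jRj' ∷ labelled-edges first (j' ∷ []) c
  labelled-edges first (j ∷ j' ∷ j'' ∷ js) (jRj' , c) = jRj' ∷ labelled-edges first (j' ∷ j'' ∷ js) c

  cycle-edges : ∀ j js → Chain Balanced (j ∷ js) j → All E (edgesOf (labelled j (j ∷ js)))
  cycle-edges j []        = labelled-edges j (j ∷ [])
  cycle-edges j (j' ∷ js) = labelled-edges j (j ∷ j' ∷ js)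

  -- The circuit of a balanced cycle: a positive circuit on the same vertices.
  circuit : ∀ {P} → Cycle P Balanced → List (Fin n × Sign)
  circuit c = labelled (Cycle.start c) (Cycle.start c ∷ Cycle.rest c)

  circuit-vertices : ∀ {P} (c : Cycle P Balanced) → map proj₁ (circuit c) ≡ Cycle.start c ∷ Cycle.rest c
  circuit-vertices c = labelled-vertices (Cycle.start c) (Cycle.start c ∷ Cycle.rest c)

  circuit-nonEmpty : ∀ {P} (c : Cycle P Balanced) → NonEmpty (circuit c)
  circuit-nonEmpty (cycle j []       _ _ _) = tt
  circuit-nonEmpty (cycle j (_ ∷ _) _ _ _) = tt

  circuit-positive : ∀ {P} (c : Cycle P Balanced) →
                     NonEmpty (circuit c) × Unique (map proj₁ (circuit c)) ×
                     All E (edgesOf (circuit c)) × foldr Sign._*_ Sign.+ (map proj₂ (circuit c)) ≡ Sign.+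
  circuit-positive c@(cycle j js distinct _ closed) =
    circuit-nonEmpty c , subst Unique (sym (circuit-vertices c)) distinct ,
    cycle-edges j js closed , trans (labelled-sign j j js) (SignP.s*s≡+ (σ j))

-- Inside a non-degenerate interval [a , b] a unit step is always possible:
-- upwards if c < b, downwards otherwise.
inward : ℤ → ℤ → Sign
inward c b with c ℤ.<? b
... | yes _ = Sign.+
... | no  _ = Sign.-

inward-step : ∀ {a b c} → a ℤ.< b → a ℤ.≤ c → c ℤ.≤ b →
              (a ℤ.≤ c ℤ.+ toℤ (inward c b)) × (c ℤ.+ toℤ (inward c b) ℤ.≤ b)
inward-step {a} {b} {c} a<b a≤c c≤b with c ℤ.<? b
... | yes c<b = ℤP.≤-trans a≤c (subst (c ℤ.≤_) (ℤP.+-comm 1ℤ c) (ℤP.i≤suc[i] c))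
              , subst (ℤ._≤ b) (ℤP.+-comm 1ℤ c) (ℤP.i<j⇒suc[i]≤j c<b)
... | no  c≮b = subst (a ℤ.≤_) (ℤP.+-comm -1ℤ c) (ℤP.i<j⇒i≤pred[j] (ℤP.<-≤-trans a<b (ℤP.≮⇒≥ c≮b)))
              , ℤP.≤-trans (subst (ℤ._≤ c) (ℤP.+-comm -1ℤ c) (ℤP.i≤j⇒pred[i]≤j ℤP.≤-refl)) c≤b

-- The ℓ¹ distance between integer vectors.
ℓ¹ : ∀ {m} → Vec ℤ m → Vec ℤ m → ℕ
ℓ¹ []       []       = 0
ℓ¹ (u ∷ us) (w ∷ ws) = ∣ u ℤ.- w ∣ ℕ.+ ℓ¹ us ws

-- Moving one coordinate closer to w moves the whole vector closer to w.
ℓ¹-update-< : ∀ {m} (us ws : Vec ℤ m) k c → ∣ c ℤ.- lookup ws k ∣ ℕ.< ∣ lookup us k ℤ.- lookup ws k ∣ →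
              ℓ¹ (us [ k ]≔ c) ws ℕ.< ℓ¹ us ws
ℓ¹-update-< (u ∷ us) (w ∷ ws) Fin.zero    c closer = ℕP.+-monoˡ-< (ℓ¹ us ws) closer
ℓ¹-update-< (u ∷ us) (w ∷ ws) (Fin.suc k) c closer = ℕP.+-monoʳ-< ∣ u ℤ.- w ∣ (ℓ¹-update-< us ws k c closer)

-- Vectors with the same entries are equal.
lookup-ext : ∀ {A : Set} {m} (us ws : Vec A m) → (∀ i → lookup us i ≡ lookup ws i) → us ≡ ws
lookup-ext us ws same = begin
  us                     ≡⟨ VecP.tabulate∘lookup us ⟨
  tabulate (lookup us)   ≡⟨ VecP.tabulate-cong same ⟩
  tabulate (lookup ws)   ≡⟨ VecP.tabulate∘lookup ws ⟩
  ws                     ∎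
  where open ≡-Reasoning

-- The heart of the proof: two fixed points p and y of F in the box that
-- agree on I are equal.  Call q good if, coordinatewise, q lies between p and
-- y and F does not push any coordinate where q differs from p back towards p
-- (y is good).  From a good q ≠ p one can step one coordinate towards p and
-- stay good; otherwise every displaced coordinate has a balanced edge to a
-- displaced coordinate in G_F(q, v) for a suitable v, and a cycle of those is
-- a positive circuit avoiding I, which is impossible.  Hence every good
-- point is p (by induction on the distance to p); in particular y = p.
module Coincidence
  {n : ℕ} (a b : Vec ℤ n) (a<b : ∀ i → lookup a i ℤ.< lookup b i)
  (F : Point n → Point n) (I : Subset n)
  (circuits-meet-I : ∀ (x : Point n) (v : Vec Sign n) → InBox a b x → InBox a b (x ⊕ v) →
                     ∀ cs → PositiveCircuit F x v cs → Any (λ e → proj₁ e ∈ I) cs)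
  {p y : Point n} (p∈X : InBox a b p) (Fp≡p : F p ≡ p) (y∈X : InBox a b y) (Fy≡y : F y ≡ y)
  (p≈y-on-I : ∀ i → i ∈ I → lookup p i ≡ lookup y i)
  where

  -- Equality of points is decidable.
  _≟_ : (x z : Point n) → Dec (x ≡ z)
  _≟_ = VecP.≡-dec ℤ._≟_

  -- The direction from p towards y in coordinate i.
  σ : Fin n → Sign
  σ i with lookup y i ℤ.<? lookup p i
  ... | yes _ = Sign.-
  ... | no  _ = Sign.+

  p≤y : ∀ i → lookup p i ≤[ σ i ] lookup y i
  p≤y i with lookup y i ℤ.<? lookup p i
  ... | yes y<p = ℤP.<⇒≤ y<p
  ... | no  y≮p = ℤP.≮⇒≥ y≮p

  between-in-box : ∀ {i u} → lookup p i ≤[ σ i ] u → u ≤[ σ i ] lookup y i →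
                   (lookup a i ℤ.≤ u) × (u ℤ.≤ lookup b i)
  between-in-box {i} = between-in-interval (σ i) (proj₁ (p∈X i)) (proj₂ (p∈X i)) (proj₁ (y∈X i)) (proj₂ (y∈X i))

  -- Coordinate i of q has not reached p yet.
  Displaced : Point n → Fin n → Set
  Displaced q i = lookup q i ≢ lookup p i

  -- q is good at i: q_i lies between p_i and y_i, and unless q_i = p_i,
  -- F does not push it back towards p_i.
  GoodAt : Point n → Fin n → Set
  GoodAt q i = (lookup p i ≤[ σ i ] lookup q i) × (lookup q i ≤[ σ i ] lookup y i) ×
               (lookup q i ≡ lookup p i ⊎ lookup q i ≤[ σ i ] lookup (F q) i)

  GoodAt? : ∀ q i → Dec (GoodAt q i)
  GoodAt? q i = (_ ≤σ? _) ×-dec (_ ≤σ? _) ×-dec ((lookup q i ℤ.≟ lookup p i) ⊎-dec (_ ≤σ? _))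

  Good : Point n → Set
  Good q = ∀ i → GoodAt q i

  -- At a displaced good coordinate, F pushes away from p.
  outward : ∀ {q i} → GoodAt q i → Displaced q i → lookup q i ≤[ σ i ] lookup (F q) i
  outward (_ , _ , inj₁ q≡p)  q≢p = ⊥-elim (q≢p q≡p)
  outward (_ , _ , inj₂ q≤Fq) _   = q≤Fq

  -- The fixed point y is good.
  y-good : Good y
  y-good i = p≤y i , ≤σ-reflexive (σ i) refl , inj₂ (≤σ-reflexive (σ i) (cong (λ z → lookup z i) (sym Fy≡y)))

  -- Good points lie in the box.
  good-in-box : ∀ {q} → Good q → InBox a b q
  good-in-box G i = between-in-box (proj₁ (G i)) (proj₁ (proj₂ (G i)))

  -- A good point is squeezed between p and y, which agree on I: so no
  -- coordinate in I is displaced.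
  good-on-I : ∀ {q i} → GoodAt q i → i ∈ I → ¬ Displaced q i
  good-on-I {q} {i} (p≤q , q≤y , _) i∈I q≢p =
    q≢p (≤σ-antisym (σ i) (subst (lookup q i ≤[ σ i ]_) (sym (p≈y-on-I i i∈I)) q≤y) p≤q)

  -- q moved one unit towards p in coordinate k.
  back : Point n → Fin n → Point n
  back q k = q [ k ]≔ retreat (σ k) (lookup q k)

  -- The direction vector v used at q: displaced coordinates point towards
  -- p, the others take any unit step that stays in the box.
  dirAt : Point n → Fin n → Sign
  dirAt q k with lookup q k ℤ.≟ lookup p k
  ... | no  _ = opposite (σ k)
  ... | yes _ = inward (lookup q k) (lookup b k)

  dir : Point n → Vec Sign n
  dir q = tabulate (dirAt q)

  -- On displaced coordinates, stepping along dir q is exactly stepping back.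
  dir-displaced : ∀ {q k} → Displaced q k → lookup (dir q) k ≡ opposite (σ k)
  dir-displaced {q} {k} q≢p = trans (VecP.lookup∘tabulate (dirAt q) k) dirAt-displaced
    where
    dirAt-displaced : dirAt q k ≡ opposite (σ k)
    dirAt-displaced with lookup q k ℤ.≟ lookup p k
    ... | yes q≡p = ⊥-elim (q≢p q≡p)
    ... | no  _   = refl

  step-dir : ∀ {q k} → Displaced q k → step q (dir q) k ≡ back q k
  step-dir {q} {k} d = cong (λ s → q [ k ]≔ (lookup q k ℤ.+ toℤ s)) (dir-displaced {q} d)

  -- The hypothesis on circuits applies at (q , dir q): both ends are in the box.
  dir-in-box : ∀ {q} → Good q → InBox a b (q ⊕ dir q)
  dir-in-box {q} G k rewrite VecP.lookup-zipWith (λ u s → u ℤ.+ toℤ s) k q (dir q)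
                           | VecP.lookup∘tabulate (dirAt q) k
    with lookup q k ℤ.≟ lookup p k
  ... | no  q≢p = between-in-box (retreat-not-past (σ k) (proj₁ (G k)) q≢p)
                                 (≤σ-trans (σ k) (<σ⇒≤σ (σ k) (retreat-< (σ k) _)) (proj₁ (proj₂ (G k))))
  ... | yes _   = inward-step (a<b k) (proj₁ (good-in-box G k)) (proj₂ (good-in-box G k))

  -- Coordinatewise, back q k stays between p and q, and only coordinates
  -- already displaced in q can be displaced in back q k.
  back-between : ∀ {q k} → Good q → Displaced q k → ∀ i →
                 (lookup p i ≤[ σ i ] lookup (back q k) i) × (lookup (back q k) i ≤[ σ i ] lookup q i) ×
                 (Displaced (back q k) i → Displaced q i)
  back-between {q} {k} G q≢p i with i FinP.≟ k
  ... | yes refl rewrite VecP.lookup∘update i q (retreat (σ i) (lookup q i)) =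
        retreat-not-past (σ i) (proj₁ (G i)) q≢p , <σ⇒≤σ (σ i) (retreat-< (σ i) _) , (λ _ → q≢p)
  ... | no  i≢k  rewrite VecP.lookup∘update′ i≢k q (retreat (σ k) (lookup q k)) =
        proj₁ (G i) , ≤σ-reflexive (σ i) refl , id

  -- If back q k is not good at i, then i is displaced in q and the step
  -- q → back q k moves F's i-th coordinate against σ i.
  not-good-after-step : ∀ {q k i} → Good q → Displaced q k → ¬ GoodAt (back q k) i →
                        Displaced q i × (lookup (F (back q k)) i <[ σ i ] lookup (F q) i)
  not-good-after-step {q} {k} {i} G q≢p bad with back-between G q≢p i
  ... | p≤b , b≤q , displaced = i-displaced , <σ-≤σ-trans (σ i) Fb<b (≤σ-trans (σ i) b≤q (outward (G i) i-displaced))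
    where
    neither : ¬ (lookup (back q k) i ≡ lookup p i ⊎ lookup (back q k) i ≤[ σ i ] lookup (F (back q k)) i)
    neither e = bad (p≤b , ≤σ-trans (σ i) b≤q (proj₁ (proj₂ (G i))) , e)
    i-displaced : Displaced q i
    i-displaced = displaced (neither ∘ inj₁)
    Fb<b : lookup (F (back q k)) i <[ σ i ] lookup (back q k) i
    Fb<b = ≰σ⇒>σ (σ i) (neither ∘ inj₂)

  -- If the step reaches p, F's k-th coordinate moves against σ k, since p is fixed.
  step-to-p : ∀ {q k} → Good q → Displaced q k → back q k ≡ p →
              lookup (F (back q k)) k <[ σ k ] lookup (F q) k
  step-to-p {q} {k} G q≢p back≡p =
    ≤σ-<σ-trans (σ k) (≤σ-reflexive (σ k) F-back≡retreat) (<σ-≤σ-trans (σ k) (retreat-< (σ k) _) (outward (G k) q≢p))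
    where
    open ≡-Reasoning
    F-back≡retreat : lookup (F (back q k)) k ≡ retreat (σ k) (lookup q k)
    F-back≡retreat = begin
      lookup (F (back q k)) k      ≡⟨ cong (λ z → lookup (F z) k) back≡p ⟩
      lookup (F p) k               ≡⟨ cong (λ z → lookup z k) Fp≡p ⟩
      lookup p k                   ≡⟨ cong (λ z → lookup z k) (sym back≡p) ⟩
      lookup (back q k) k          ≡⟨ VecP.lookup∘update k q _ ⟩
      retreat (σ k) (lookup q k)   ∎

  -- The local interaction graph at (q , dir q) and its σ-balanced edges.
  Graph : Point n → Edge n → Set
  Graph q = InLocalGraph F q (dir q)

  open BalancedCycles σ using (Balanced; circuit; circuit-vertices; circuit-positive)

  -- A move of F's i-th coordinate against σ i along the step towards p in
  -- coordinate k is a balanced edge k → i of the local graph.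
  decrease⇒edge : ∀ {q k i} → Displaced q k → lookup (F (back q k)) i <[ σ i ] lookup (F q) i →
                  Balanced (Graph q) k i
  decrease⇒edge {q} {k} {i} q≢p Fb<Fq =
    inLocalGraph F q (dir q) k i (σ k Sign.* σ i)
      (subst (HasSign (σ k Sign.* σ i)) (sym quotient) (quotient-sign (σ k) (σ i) Fb<Fq))
    where
    quotient : fij F q (dir q) i k ≡ toℤ (opposite (σ k)) ℤ.* (lookup (F (back q k)) i ℤ.- lookup (F q) i)
    quotient = cong₂ (λ s z → toℤ s ℤ.* (lookup (F z) i ℤ.- lookup (F q) i)) (dir-displaced {q} q≢p) (step-dir q≢p)

  -- q descends: some step towards p leads to a good point other than p.
  Descends : Point n → Fin n → Set
  Descends q k = Displaced q k × back q k ≢ p × Good (back q k)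

  descends? : ∀ q k → Dec (Descends q k)
  descends? q k = ¬? (lookup q k ℤ.≟ lookup p k) ×-dec ¬? (back q k ≟ p) ×-dec FinP.all? (GoodAt? (back q k))

  -- If q does not descend, every displaced coordinate has a balanced edge to
  -- a displaced coordinate.
  successor : ∀ {q} → Good q → (∀ k → ¬ Descends q k) →
              ∀ k → Displaced q k → Σ (Fin n) λ i → Displaced q i × Balanced (Graph q) k i
  successor {q} G stuck k q≢p with back q k ≟ p
  ... | yes back≡p = k , q≢p , decrease⇒edge q≢p (step-to-p G q≢p back≡p)
  ... | no  back≢p with FinP.¬∀⟶∃¬ n _ (GoodAt? (back q k)) (λ good → stuck k (q≢p , back≢p , good))
  ...   | i , bad = i , proj₁ (not-good-after-step G q≢p bad) , decrease⇒edge q≢p (proj₂ (not-good-after-step G q≢p bad))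

  -- A balanced cycle of displaced coordinates would be a positive circuit of
  -- G_F(q , dir q) avoiding I.
  no-displaced-cycle : ∀ {q} → Good q → ¬ Cycle (Displaced q) (Balanced (Graph q))
  no-displaced-cycle {q} G c = good-on-I (G _) (proj₂ witness) (proj₁ witness)
    where
    meets-I : Any (_∈ I) (Cycle.start c ∷ Cycle.rest c)
    meets-I = subst (Any (_∈ I)) (circuit-vertices (Graph q) c)
                (AnyP.map⁺ (circuits-meet-I q (dir q) (good-in-box G) (dir-in-box G) (circuit (Graph q) c) (circuit-positive (Graph q) c)))
    witness : Displaced q (Any.lookup meets-I) × Any.lookup meets-I ∈ I
    witness = All.lookupAny (Cycle.inside c) meets-I

  -- Every good point is p, by induction on its distance to p.
  good-is-p : ∀ m {q} → ℓ¹ q p ℕ.< m → Good q → ¬ q ≢ p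
  good-is-p zero    ()
  good-is-p (suc m) {q} near G q≢p with FinP.any? (descends? q)
  ... | yes (k , k-displaced , back≢p , back-good) =
        good-is-p m (ℕP.<-≤-trans closer (ℕ.s≤s⁻¹ near)) back-good back≢p
    where
    closer : ℓ¹ (back q k) p ℕ.< ℓ¹ q p
    closer = ℓ¹-update-< q p k _ (retreat-closer (σ k) (proj₁ (G k)) k-displaced)
  ... | no  stuck with FinP.¬∀⟶∃¬ n (λ k → lookup q k ≡ lookup p k) (λ k → lookup q k ℤ.≟ lookup p k)
                         (q≢p ∘ lookup-ext q p)
  ...   | k , k-displaced =
          no-displaced-cycle G (CycleSearch.findCycle (successor G (λ k d → stuck (k , d))) k k-displaced)

  -- Two fixed points that agree on I coincide.
  coincide : p ≡ y
  coincide = sym (decidable-stable (y ≟ p) (good-is-p (suc (ℓ¹ y p)) (ℕP.n<1+n _) y-good))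

-- Distinct fixed points in X have distinct I-coordinates, hence distinct
-- codes in Fin (∏_{i ∈ I} |X_i|); count them by pigeonhole.
theorem3 : (n : ℕ) (a b : Vec ℤ n) → ((i : Fin n) → lookup a i < lookup b i) →
    (F : Point n → Point n) → (∀ x → InBox a b x → InBox a b (F x)) →
    (I : Subset n) →
    (∀ (x : Point n) (v : Vec Sign n) → InBox a b x → InBox a b (x ⊕ v) →
      ∀ (cs : List (Fin n × Sign)) → PositiveCircuit F x v cs →
      Any (λ e → proj₁ e ∈ I) cs) →
    ∀ (fps : List (Point n)) → Unique fps →
    All (λ x → InBox a b x × F x ≡ x) fps →
    length fps ≤ ∏∈ I (size a b)
theorem3 n a b a<b F _ I circuits-meet-I fps fps! fixed = begin
  length fps                       ≡⟨ ListP.length-map code fps ⟨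
  length (map code fps)            ≤⟨ unique-length-≤ (map code fps) (unique-map-on code same-code⇒same fixed fps!) ⟩
  ∏∈ I (size a b)                  ∎
  where
  open ℕP.≤-Reasoning
  code : Point n → Fin (∏∈ I (size a b))
  code = encode a b I
  same-code⇒same : ∀ {x z} → InBox a b x × F x ≡ x → InBox a b z × F z ≡ z → code x ≡ code z → x ≡ z
  same-code⇒same (x∈X , Fx≡x) (z∈X , Fz≡z) same =
    Coincidence.coincide a b a<b F I circuits-meet-I x∈X Fx≡x z∈X Fz≡z
      (encode-injective-on a b I x∈X z∈X same)
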